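{- Fix $\lambda_H,\lambda_E>0$, $p_E\in(0,1]$ and an integer $d\ge1$ (independent of $p_H$). Under the ChainMatch(d) policy and in steady-state, the chain-segment length $L$ satisfies $$\lim_{p_H\to0}\mathbb{E}[L\mid L\ge1]=\frac{\lambda_H+\lambda_E(1-p_E)^d}{\lambda_E(1-(1-p_E)^d)}+1.$$
   Context: Model: agents of two types $H$ (hard-to-match) and $E$ (easy-to-match) arrive to a market according to independent Poisson processes with rates $\lambda_H,\lambda_E>0$. Each agent owns an item; an agent of type $T\in\{H,E\}$ finds the item of any other agent compatible with probability $p_T$, independently over all ordered pairs; there is a directed edge from $i$ to $j$ if $j$ finds $i$'s item compatible. Here $p_E\in(0,1]$ is a fixed constant and $p_H\in(0,1)$ is a parameter tending to $0$. A waiting agent leaves only when matched, i.e. when she receives a compatible item. Policy ChainMatch(d) ($\mathcal{C}(d)$): the market starts with $d$ altruistic agents, who give an item without requiring one; at all times there are exactly $d$ bridge agents (an altruistic agent who has not yet given, or an agent who has received an item but not yet given hers). When a new agent $i_1$ arrives: if no bridge agent has an edge to $i_1$, then $i_1$ joins the market and waits. Otherwise one of the bridge agents with an edge to $i_1$ is chosen uniformly at random and gives her item to $i_1$ (ceasing to be a bridge agent), starting a chain-segment. The chain-segment advances instantaneously by local search: if the current last agent has an edge to at least one waiting agent not already in the chain-segment, one of these is selected at random, with $H$ agents favored over $E$ agents, is matched by the last agent and becomes the new last agent; this is repeated until the last agent has no edge to a remaining waiting agent. All agents of the chain-segment leave the market, and the last one becomes a bridge agent. The numbers of waiting (non-bridge)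 $H$ and $E$ agents form a positive recurrent continuous-time Markov chain (each edge is examined at most once, so edges may be revealed only when examined). Let $[H_k,E_k]$ be the embedded discrete-time Markov chain obtained by observing the system at arrival epochs (each arrival advances $k$ to $k+1$). The chain-segment length is $L_k=H_k+E_k-H_{k+1}-E_{k+1}+1$, so $L_k=0$ if the arriving agent is not matched by a bridge agent and joins the market, and $L_k\ge1$ is the number of agents in the chain-segment (including the arriving one) otherwise. $L$ is the corresponding random variable in steady-state. -}

module Defs where

open import Algebra.Bundles using (CommutativeRing; module Semiring)
import Algebra.Definitions.RawSemiring as RawSemiringDefinitions
open import Data.Bool.Base using (Bool; true; false; if_then_else_; _∨_)
open import Data.Fin.Base using (toℕ)
open import Data.Integer.Base as ℤ using (ℤ; +_; -[1+_]; _⊖_)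
import Data.Integer.Properties as ℤ
open import Data.Nat.Base as ℕ using (ℕ; zero; suc)
import Data.Nat.Properties as ℕ
open import Data.Product.Base using (Σ-syntax; ∃-syntax; _×_; _,_)
open import Data.Product.Properties using (≡-dec)
open import Level using (0ℓ)
open import Relation.Binary.Core using (Rel)
open import Relation.Binary.Structures using (IsTotalOrder)
import Relation.Binary.Construct.NonStrictToStrict as NonStrictToStrict
open import Relation.Nullary using (¬_; does)

-- The real numbers, given by the axioms of a Dedekind-complete ordered
-- field, which determine them up to isomorphism.
record RealField : Set₁ where
  infix  4 _≤_
  infix  8 _⁻¹
  infixl 7 _/_

  field
    commutativeRing : CommutativeRing 0ℓ 0ℓ

  open CommutativeRing commutativeRing public
    renaming (Carrier to ℝ; zero to *-zero)

  field
    _≤_          : Rel ℝ 0ℓ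
    isTotalOrder : IsTotalOrder _≈_ _≤_
    +-monoʳ-≤    : ∀ x {y z} → y ≤ z → x + y ≤ x + z
    *-nonneg     : ∀ {x y} → 0# ≤ x → 0# ≤ y → 0# ≤ x * y
    0≉1          : ¬ (0# ≈ 1#)
    -- Total inverse; its value at 0# is left unspecified.
    _⁻¹          : ℝ → ℝ
    ⁻¹-cong      : ∀ {x y} → x ≈ y → x ⁻¹ ≈ y ⁻¹
    ⁻¹-inverseʳ  : ∀ {x} → ¬ (x ≈ 0#) → x * x ⁻¹ ≈ 1#

  UpperBound : (ℝ → Set) → ℝ → Set
  UpperBound P u = ∀ x → P x → x ≤ u

  field
    complete : (P : ℝ → Set) → (∃[ x ] P x) → (∃[ u ] UpperBound P u) →
               ∃[ s ] (UpperBound P s × (∀ u → UpperBound P u → s ≤ u))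

  open NonStrictToStrict _≈_ _≤_ public using (_<_)
  open RawSemiringDefinitions (Semiring.rawSemiring semiring) public
    using (_^_; sum)
    renaming (_×_ to _×ᴿ_)

  _/_ : ℝ → ℝ → ℝ
  x / y = x * y ⁻¹

  fromℤ : ℤ → ℝ
  fromℤ (+ n)    = n ×ᴿ 1#
  fromℤ -[1+ n ] = - (suc n ×ᴿ 1#)

data AgentType : Set where
  H E : AgentType

-- (number of waiting H agents , number of waiting E agents)
State : Set
State = ℕ × ℕ

-- L_k as a function of the states at epochs k and k + 1.
segmentLength : State → State → ℤ
segmentLength (h , e) (h′ , e′) = suc (h ℕ.+ e) ⊖ (h′ ℕ.+ e′)

module Analysis (R : RealField) where
  open RealField R

  -- ∣ x - y ∣ < ε
  Within : ℝ → ℝ → ℝ → Set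
  Within ε x y = (x - y < ε) × (y - x < ε)

  -- f x → l as x → 0 from the right.
  Limit0⁺ : (ℝ → ℝ) → ℝ → Set
  Limit0⁺ f l =
    ∀ ε → 0# < ε → ∃[ δ ] (0# < δ × (∀ x → 0# < x → x < δ → Within ε (f x) l))

  squareSum : (State → ℝ) → ℕ → ℝ
  squareSum f n = sum {n} λ i → sum {n} λ j → f (toℕ i , toℕ j)

  -- Convergence of the double series along squares. It is applied only to
  -- nonnegative terms, for which the order of summation is irrelevant.
  HasSum : (State → ℝ) → ℝ → Set
  HasSum f v =
    ∀ ε → 0# < ε → ∃[ N ] (∀ n → N ℕ.≤ n → Within ε (squareSum f n) v)

  -- Finite random experiments: flip p x y continues as x with probability p
  -- and as y with probability 1 - p, independently of all other flips.
  data Random (A : Set) : Set where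
    return : A → Random A
    flip   : ℝ → Random A → Random A → Random A

  infixl 1 _>>=_

  _>>=_ : {A B : Set} → Random A → (A → Random B) → Random B
  return a   >>= k = k a
  flip p x y >>= k = flip p (x >>= k) (y >>= k)

  bernoulli : ℝ → Random Bool
  bernoulli p = flip p (return true) (return false)

  𝔼 : {A : Set} → Random A → (A → ℝ) → ℝ
  𝔼 (return a)   f = f a
  𝔼 (flip p x y) f = p * 𝔼 x f + (1# - p) * 𝔼 y f

  𝟙 : Bool → ℝ
  𝟙 b = if b then 1# else 0#

  -- Transition kernels, their stationary distributions, and expectations of
  -- f (X k) (X (k + 1)) when X k has distribution π.
  Kernel : Set
  Kernel = State → Random State

  transition : Kernel → State → State → ℝ
  transition K s t = 𝔼 (K s) λ s′ → 𝟙 (does (≡-dec ℕ._≟_ ℕ._≟_ s′ t))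

  record IsStationary (K : Kernel) (π : State → ℝ) : Set where
    field
      nonneg    : ∀ s → 0# ≤ π s
      total     : HasSum π 1#
      invariant : ∀ t → HasSum (λ s → π s * transition K s t) (π t)

  HasExpectation : Kernel → (State → ℝ) → (State → State → ℝ) → ℝ → Set
  HasExpectation K π f v = HasSum (λ s → π s * 𝔼 (K s) (f s)) v

  matched : State → State → ℝ
  matched s s′ = 𝟙 (does (+ 1 ℤ.≤? segmentLength s s′))

  -- m is E[L | L ≥ 1], that is E[L ; L ≥ 1] / P(L ≥ 1), where both series
  -- are required to converge and P(L ≥ 1) to be nonzero.
  IsMeanSegmentLength : Kernel → (State → ℝ) → ℝ → Set
  IsMeanSegmentLength K π m =
    Σ[ a ∈ ℝ ] Σ[ b ∈ ℝ ]
      HasExpectation K π (λ s s′ → fromℤ (segmentLength s s′) * matched s s′) a ×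
      HasExpectation K π matched b ×
      ¬ (b ≈ 0#) ×
      m ≈ a / b

-- The embedded chain of ChainMatch(d). Each edge is sampled when it is
-- examined. Which of several compatible bridge agents (or waiting agents of
-- the same type) is selected has no effect on the numbers of waiting agents,
-- so that selection is not represented. Every arrival leaves the number of
-- bridge agents equal to d: a used bridge agent is replaced by the last agent
-- of the chain-segment.
module ChainMatch (R : RealField) (λH λE pE : RealField.ℝ R) (d : ℕ)
                  (pH : RealField.ℝ R) where
  open RealField R
  open Analysis R

  -- The probability of an edge depends only on the type of its head.
  p : AgentType → ℝ
  p H = pH
  p E = pE

  -- Is there an edge among n independent candidates of probability q?
  anyEdge : ℕ → ℝ → Random Bool
  anyEdge zero    q = return false
  anyEdge (suc n) q = do
    here  ← bernoulli q
    there ← anyEdge n q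
    return (here ∨ there)

  -- Advances the chain-segment from its current last agent, with the given
  -- numbers of H and E agents still waiting outside the segment, and returns
  -- the numbers left when the segment stops.
  localSearch : (h e : ℕ) → Random State
  localSearch zero    zero    = return (zero , zero)
  localSearch (suc h) zero    = do
    toH ← anyEdge (suc h) (p H)
    if toH then localSearch h zero else return (suc h , zero)
  localSearch zero    (suc e) = do
    toE ← anyEdge (suc e) (p E)
    if toE then localSearch zero e else return (zero , suc e)
  localSearch (suc h) (suc e) = do
    toH ← anyEdge (suc h) (p H)
    toE ← anyEdge (suc e) (p E)
    if toH then localSearch h (suc e)
      else if toE then localSearch (suc h) e
      else return (suc h , suc e)

  join : AgentType → State → State
  join H (h , e) = suc h , e
  join E (h , e) = h , suc e

  arrivalOf : AgentType → Kernel
  arrivalOf T (h , e) = do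
    fromBridge ← anyEdge d (p T)
    if fromBridge then localSearch h e else return (join T (h , e))

  -- With independent Poisson arrivals of rates λH and λE, the types of
  -- successive arrivals are independent and are H with probability
  -- λH / (λH + λE).
  step : Kernel
  step s = do
    isH ← bernoulli (λH / (λH + λE))
    arrivalOf (if isH then H else E) s

{-# OPTIONS --safe #-}

-- In a stationary state the number of waiting agents does not drift, so one
-- agent leaves per arrival on average: E[L] = 1. Since L = 0 unless the arrival
-- is matched by a bridge agent, E[L | L ≥ 1] = 1 / P(L ≥ 1), where
--   P(L ≥ 1) = q (1 - (1 - pH) ^ d) + (1 - q) (1 - (1 - pE) ^ d),
-- q = λH / (λH + λE), in every state, and its first summand is at most q d pH.
--
-- The number of waiting agents need not be integrable. Stationarity is applied
-- instead to the finitely supported functions φ = max (N - h - e, 0). The increment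
-- of φ along a step is L - 1 when h + e < N; it is always at least -1, because a
-- single agent arrives, and at most L. Hence the partial sums of E[L] are at most 1
-- and eventually exceed 1 - ε.
module Submission where

open import Algebra.Properties.AbelianGroup as AbelianGroupProperties using ()
open import Algebra.Properties.CommutativeMonoid.Sum as CommutativeMonoidSum using ()
open import Algebra.Properties.CommutativeSemigroup as CommutativeSemigroupProperties using ()
open import Algebra.Properties.Ring as RingProperties using ()
open import Algebra.Properties.Semiring.Mult as SemiringMult using ()
open import Algebra.Properties.Semiring.Sum as SemiringSum using ()
open import Algebra.Solver.Ring.NaturalCoefficients.Default as SemiringSolver using ()
open import Axiom.ExcludedMiddle using (ExcludedMiddle)
open import Data.Bool.Base using (Bool; true; false; if_then_else_)
open import Data.Empty using (⊥-elim)
open import Data.Fin.Base using (toℕ)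
open import Data.Fin.Properties using (toℕ<n)
open import Data.Integer.Base using (+_)
import Data.Integer.Properties as ℤ
open import Data.Nat.Base as ℕ using (ℕ; zero; suc)
import Data.Nat.Properties as ℕ
open import Data.Product.Base using (Σ-syntax; ∃-syntax; _×_; _,_; proj₁; proj₂)
open import Data.Product.Properties using (≡-dec)
open import Data.Sum.Base using (inj₁; inj₂)
open import Data.Unit.Base using (⊤; tt)
open import Function.Base using (_∘_)
open import Level using (0ℓ)
open import Relation.Binary.Bundles using (Poset)
import Relation.Binary.Construct.NonStrictToStrict as NonStrictToStrict
open import Relation.Binary.PropositionalEquality as ≡ using (_≡_)
import Relation.Binary.Reasoning.PartialOrder as PartialOrderReasoning
open import Relation.Binary.Structures using (IsTotalOrder)
open import Relation.Nullary using (¬_; Dec; does; yes; no)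
open import Defs

-- Arithmetic of an ordered field.

module OrderedField (R : RealField) where
  open RealField R
  open Analysis R
  open IsTotalOrder isTotalOrder public
    using (total; antisym; isPartialOrder; ≤-respʳ-≈; ≤-respˡ-≈)
    renaming (refl to ≤-refl; reflexive to ≤-reflexive; trans to ≤-trans)

  poset : Poset 0ℓ 0ℓ 0ℓ
  poset = record { isPartialOrder = isPartialOrder }

  open PartialOrderReasoning poset
  open NonStrictToStrict _≈_ _≤_ using (<⇒≤; <⇒≱)
  open AbelianGroupProperties +-abelianGroup
    using (//-rightDividesˡ; //-rightDividesʳ; ∙-cancelʳ)
  open SemiringSolver commutativeSemiring

  x+[y-x]≈y : ∀ x y → x + (y - x) ≈ y
  x+[y-x]≈y x y = trans (+-comm x (y - x)) (//-rightDividesˡ x y)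

  +-monoˡ-≤ : ∀ z {x y} → x ≤ y → x + z ≤ y + z
  +-monoˡ-≤ z {x} {y} x≤y = begin
    x + z ≈⟨ +-comm x z ⟩
    z + x ≤⟨ +-monoʳ-≤ z x≤y ⟩
    z + y ≈⟨ +-comm z y ⟩
    y + z ∎

  +-mono-≤ : ∀ {x y u v} → x ≤ y → u ≤ v → x + u ≤ y + v
  +-mono-≤ {y = y} {u} x≤y u≤v = ≤-trans (+-monoˡ-≤ u x≤y) (+-monoʳ-≤ y u≤v)

  +-nonneg : ∀ {x y} → 0# ≤ x → 0# ≤ y → 0# ≤ x + y
  +-nonneg 0≤x 0≤y = ≤-respˡ-≈ (+-identityˡ 0#) (+-mono-≤ 0≤x 0≤y)

  +-monoˡ-< : ∀ z {x y} → x < y → x + z < y + z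
  +-monoˡ-< z {x} {y} (x≤y , x≉y) =
    +-monoˡ-≤ z x≤y , λ eq → x≉y (∙-cancelʳ z x y eq)

  +-mono-< : ∀ {x y u v} → x < y → u < v → x + u < y + v
  +-mono-< {x} {y} {u} {v} x<y u<v = begin-strict
    x + u <⟨ +-monoˡ-< u x<y ⟩
    y + u ≤⟨ +-monoʳ-≤ y (<⇒≤ u<v) ⟩
    y + v ∎

  ≤-+⇒--≤ : ∀ {x y z} → x ≤ y + z → x - z ≤ y
  ≤-+⇒--≤ {x} {y} {z} p =
    ≤-respʳ-≈ (//-rightDividesʳ z y) (+-monoˡ-≤ (- z) p)

  +-≤⇒≤-- : ∀ {x y z} → x + z ≤ y → x ≤ y - z
  +-≤⇒≤-- {x} {y} {z} p =
    ≤-respˡ-≈ (//-rightDividesʳ z x) (+-monoˡ-≤ (- z) p)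

  -- Closeness is established in additive form, where monotonicity of addition applies directly, and
  -- converted to differences only at the end.
  within : ∀ {ε x y} → x < y + ε → y < x + ε → Within ε x y
  within p q = move p , move q
    where
    move : ∀ {ε x y} → x < y + ε → x - y < ε
    move {ε} {x} {y} p = begin-strict
      x - y       <⟨ +-monoˡ-< (- y) p ⟩
      y + ε - y   ≈⟨ +-congʳ (+-comm y ε) ⟩
      ε + y - y   ≈⟨ //-rightDividesʳ y ε ⟩
      ε           ∎

  -<⇒<+ : ∀ {ε x y} → x - y < ε → x < y + ε
  -<⇒<+ {ε} {x} {y} p = begin-strict
    x           ≈⟨ //-rightDividesˡ y x ⟨
    x - y + y   <⟨ +-monoˡ-< y p ⟩
    ε + y       ≈⟨ +-comm ε y ⟩
    y + ε       ∎

  x≤y⇒0≤y-x : ∀ {x y} → x ≤ y → 0# ≤ y - x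
  x≤y⇒0≤y-x {x} {y} p = +-≤⇒≤-- (≤-respˡ-≈ (sym (+-identityˡ x)) p)

  *-monoˡ-≤ : ∀ {c x y} → 0# ≤ c → x ≤ y → c * x ≤ c * y
  *-monoˡ-≤ {c} {x} {y} 0≤c x≤y = begin
    c * x                 ≈⟨ +-identityʳ (c * x) ⟨
    c * x + 0#            ≤⟨ +-monoʳ-≤ (c * x) (*-nonneg 0≤c (x≤y⇒0≤y-x x≤y)) ⟩
    c * x + c * (y - x)   ≈⟨ distribˡ c x (y - x) ⟨
    c * (x + (y - x))     ≈⟨ *-congˡ (x+[y-x]≈y x y) ⟩
    c * y                 ∎

  *-monoʳ-≤ : ∀ {c x y} → 0# ≤ c → x ≤ y → x * c ≤ y * c
  *-monoʳ-≤ {c} {x} {y} 0≤c x≤y = begin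
    x * c ≈⟨ *-comm x c ⟩
    c * x ≤⟨ *-monoˡ-≤ 0≤c x≤y ⟩
    c * y ≈⟨ *-comm c y ⟩
    y * c ∎

  0≤1 : 0# ≤ 1#
  0≤1 with total 0# 1#
  ... | inj₁ p = p
  ... | inj₂ 1≤0 = begin
    0#             ≤⟨ *-nonneg 0≤-1 0≤-1 ⟩
    i * i          ≈⟨ +-identityʳ (i * i) ⟨
    -- The semiring solver knows no negation, so `i` stays an atom. Its only relation,
    -- `1# + i ≈ 0#`, is inserted here and used again to remove `i` two lines below.
    i * i + 0#     ≈⟨ +-congˡ (x+[y-x]≈y 1# 0#) ⟨
    i * i + (1# + i) ≈⟨ solve 1 (λ i → i :* i :+ (con 1 :+ i) := i :* (con 1 :+ i) :+ con 1) refl i ⟩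
    i * (1# + i) + 1# ≈⟨ +-congʳ (trans (*-congˡ (x+[y-x]≈y 1# 0#)) (zeroʳ i)) ⟩
    0# + 1#        ≈⟨ +-identityˡ 1# ⟩
    1#             ∎
    where
    i = 0# - 1#
    0≤-1 : 0# ≤ i
    0≤-1 = x≤y⇒0≤y-x 1≤0

  0<1 : 0# < 1#
  0<1 = 0≤1 , 0≉1

  pos⇒≉0 : ∀ {x} → 0# < x → ¬ (x ≈ 0#)
  pos⇒≉0 0<x x≈0 = proj₂ 0<x (sym x≈0)

  inverseʳ : ∀ {x} → 0# < x → x * x ⁻¹ ≈ 1#
  inverseʳ 0<x = ⁻¹-inverseʳ (pos⇒≉0 0<x)

  *-cancelˡ-≈ : ∀ {c x y} → 0# < c → c * x ≈ c * y → x ≈ y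
  *-cancelˡ-≈ {c} {x} {y} 0<c eq = begin-equality
    x               ≈⟨ expand x ⟩
    c ⁻¹ * (c * x)  ≈⟨ *-congˡ eq ⟩
    c ⁻¹ * (c * y)  ≈⟨ expand y ⟨
    y               ∎
    where
    expand : ∀ z → z ≈ c ⁻¹ * (c * z)
    expand z = begin-equality
      z              ≈⟨ *-identityˡ z ⟨
      1# * z         ≈⟨ *-congʳ (inverseʳ 0<c) ⟨
      c * c ⁻¹ * z   ≈⟨ solve 3 (λ c d z → c :* d :* z := d :* (c :* z)) refl c (c ⁻¹) z ⟩
      c ⁻¹ * (c * z) ∎

  *-monoˡ-< : ∀ {c x y} → 0# < c → x < y → c * x < c * y
  *-monoˡ-< 0<c (x≤y , x≉y) =
    *-monoˡ-≤ (<⇒≤ 0<c) x≤y , λ eq → x≉y (*-cancelˡ-≈ 0<c eq)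

  *-cancelˡ-< : ∀ {c x y} → 0# < c → c * x < c * y → x < y
  *-cancelˡ-< {c} {x} {y} 0<c cx<cy with total x y
  ... | inj₁ x≤y = x≤y , λ x≈y → proj₂ cx<cy (*-congˡ x≈y)
  ... | inj₂ y≤x = ⊥-elim (<⇒≱ antisym cx<cy (*-monoˡ-≤ (<⇒≤ 0<c) y≤x))

  *-pos : ∀ {x y} → 0# < x → 0# < y → 0# < x * y
  *-pos {x} {y} 0<x 0<y = begin-strict
    0#     ≈⟨ zeroʳ x ⟨
    x * 0# <⟨ *-monoˡ-< 0<x 0<y ⟩
    x * y  ∎

  ⁻¹-pos : ∀ {x} → 0# < x → 0# < x ⁻¹
  ⁻¹-pos {x} 0<x = *-cancelˡ-< 0<x (begin-strict
    x * 0#   ≈⟨ zeroʳ x ⟩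
    0#       <⟨ 0<1 ⟩
    1#       ≈⟨ inverseʳ 0<x ⟨
    x * x ⁻¹ ∎)

  +-pos : ∀ {x y} → 0# < x → 0# ≤ y → 0# < x + y
  +-pos {x} {y} 0<x 0≤y = begin-strict
    0#     <⟨ 0<x ⟩
    x      ≈⟨ +-identityʳ x ⟨
    x + 0# ≤⟨ +-monoʳ-≤ x 0≤y ⟩
    x + y  ∎

  *-scale : ∀ {c ε} → 0# ≤ c → 0# < ε →
            ∃[ δ ] (0# < δ × (∀ {x} → x < δ → c * x < ε))
  *-scale {c} {ε} 0≤c 0<ε = δ , 0<δ , bound
    where
    0<1+c : 0# < 1# + c
    0<1+c = +-pos 0<1 0≤c
    -- Dividing by `1# + c` instead of `c` covers `c ≈ 0#` and leaves the slack `δ` that makes the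
    -- bound strict.
    δ = ε * (1# + c) ⁻¹
    0<δ : 0# < δ
    0<δ = *-pos 0<ε (⁻¹-pos 0<1+c)
    bound : ∀ {x} → x < δ → c * x < ε
    bound {x} x<δ = begin-strict
      c * x        ≤⟨ *-monoˡ-≤ 0≤c (<⇒≤ x<δ) ⟩
      c * δ        ≈⟨ +-identityˡ (c * δ) ⟨
      0# + c * δ   <⟨ +-monoˡ-< (c * δ) 0<δ ⟩
      δ + c * δ    ≈⟨ solve 3 (λ e c i → e :* i :+ c :* (e :* i) := e :* ((con 1 :+ c) :* i)) refl ε c ((1# + c) ⁻¹) ⟩
      ε * ((1# + c) * (1# + c) ⁻¹) ≈⟨ *-congˡ (inverseʳ 0<1+c) ⟩
      ε * 1#       ≈⟨ *-identityʳ ε ⟩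
      ε            ∎

  half : ∀ {ε} → 0# < ε → ∃[ δ ] (0# < δ × δ + δ ≈ ε)
  half {ε} 0<ε = ε * i , *-pos 0<ε (⁻¹-pos 0<2) , (begin-equality
    ε * i + ε * i    ≈⟨ solve 2 (λ e i → e :* i :+ e :* i := e :* ((con 1 :+ con 1) :* i)) refl ε i ⟩
    ε * ((1# + 1#) * i) ≈⟨ *-congˡ (inverseʳ 0<2) ⟩
    ε * 1#           ≈⟨ *-identityʳ ε ⟩
    ε                ∎)
    where
    0<2 : 0# < 1# + 1#
    0<2 = +-pos 0<1 0≤1
    i = (1# + 1#) ⁻¹

  min-pos : ∀ {a b} → 0# < a → 0# < b → ∃[ δ ] (0# < δ × δ ≤ a × δ ≤ b)
  min-pos {a} {b} 0<a 0<b with total a b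
  ... | inj₁ a≤b = a , 0<a , ≤-refl , a≤b
  ... | inj₂ b≤a = b , 0<b , b≤a , ≤-refl

  ×1-nonneg : ∀ n → 0# ≤ n ×ᴿ 1#
  ×1-nonneg zero    = ≤-refl
  ×1-nonneg (suc n) = +-nonneg 0≤1 (×1-nonneg n)

  ×1-mono-≤ : ∀ {m n} → m ℕ.≤ n → m ×ᴿ 1# ≤ n ×ᴿ 1#
  ×1-mono-≤ {n = n} ℕ.z≤n = ×1-nonneg n
  ×1-mono-≤ (ℕ.s≤s m≤n)   = +-monoʳ-≤ 1# (×1-mono-≤ m≤n)

  -- Multiplied by b * c, the nontrivial half b ⁻¹ < c ⁻¹ + ε reads
  -- c < b + ε * (b * c).
  ⁻¹-within : ∀ {ε b c} → 0# < ε → 0# < b → b ≤ c → c < b + ε * (b * b) →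
              Within ε (c ⁻¹) (b ⁻¹)
  ⁻¹-within {ε} {b} {c} 0<ε 0<b b≤c c<b+εb² =
    within (*-cancelˡ-< 0<bc upper) (*-cancelˡ-< 0<bc lower)
    where
    0<c : 0# < c
    0<c = begin-strict
      0# <⟨ 0<b ⟩
      b  ≤⟨ b≤c ⟩
      c  ∎
    0<bc : 0# < b * c
    0<bc = *-pos 0<b 0<c
    [bc]c⁻¹ : b * c * c ⁻¹ ≈ b
    [bc]c⁻¹ = trans (*-assoc b c (c ⁻¹))
                    (trans (*-congˡ (inverseʳ 0<c)) (*-identityʳ b))
    [bc]b⁻¹ : b * c * b ⁻¹ ≈ c
    [bc]b⁻¹ = trans (*-congʳ (*-comm b c))
                    (trans (*-assoc c b (b ⁻¹))
                           (trans (*-congˡ (inverseʳ 0<b)) (*-identityʳ c)))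
    upper : b * c * c ⁻¹ < b * c * (b ⁻¹ + ε)
    upper = begin-strict
      b * c * c ⁻¹                 ≈⟨ [bc]c⁻¹ ⟩
      b                            ≤⟨ b≤c ⟩
      c                            ≈⟨ +-identityˡ c ⟨
      0# + c                       <⟨ +-monoˡ-< c (*-pos 0<bc 0<ε) ⟩
      b * c * ε + c                ≈⟨ +-comm (b * c * ε) c ⟩
      c + b * c * ε                ≈⟨ +-congʳ [bc]b⁻¹ ⟨
      b * c * b ⁻¹ + b * c * ε     ≈⟨ distribˡ (b * c) (b ⁻¹) ε ⟨
      b * c * (b ⁻¹ + ε)           ∎
    lower : b * c * b ⁻¹ < b * c * (c ⁻¹ + ε)
    lower = begin-strict
      b * c * b ⁻¹                 ≈⟨ [bc]b⁻¹ ⟩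
      c                            <⟨ c<b+εb² ⟩
      b + ε * (b * b)              ≤⟨ +-monoʳ-≤ b (*-monoˡ-≤ (<⇒≤ 0<ε) (*-monoˡ-≤ (<⇒≤ 0<b) b≤c)) ⟩
      b + ε * (b * c)              ≈⟨ +-cong (sym [bc]c⁻¹) (*-comm ε (b * c)) ⟩
      b * c * c ⁻¹ + b * c * ε     ≈⟨ distribˡ (b * c) (c ⁻¹) ε ⟨
      b * c * (c ⁻¹ + ε)           ∎

-- Finite sums over squares of states.

InSquare : ℕ → State → Set
InSquare n (h , e) = h ℕ.< n × e ℕ.< n

module Summation (R : RealField) where
  open RealField R
  open Analysis R
  open OrderedField R
  open PartialOrderReasoning poset
  open NonStrictToStrict _≈_ _≤_ using (<⇒≤)
  open AbelianGroupProperties +-abelianGroup using (⁻¹-∙-comm; ⁻¹-involutive; ε⁻¹≈ε)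
  open RingProperties ring using (x[y-z]≈xy-xz)
  open CommutativeSemigroupProperties +-commutativeSemigroup using (interchange)
  open SemiringSolver commutativeSemiring using (solve; _:=_; _:+_; _:*_)

  sumTo : ℕ → (ℕ → ℝ) → ℝ
  sumTo n f = sum {n} λ i → f (toℕ i)

  sumTo-cong : ∀ n f g → (∀ i → i ℕ.< n → f i ≈ g i) → sumTo n f ≈ sumTo n g
  sumTo-cong n f g f≈g = CommutativeMonoidSum.sum-cong-≋ +-commutativeMonoid
    {n} {f ∘ toℕ} {g ∘ toℕ} (λ i → f≈g (toℕ i) (toℕ<n i))

  sumTo-+ : ∀ n f g → sumTo n (λ i → f i + g i) ≈ sumTo n f + sumTo n g
  sumTo-+ n f g = CommutativeMonoidSum.∑-distrib-+ +-commutativeMonoid {n}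
    (f ∘ toℕ) (g ∘ toℕ)

  sumTo-* : ∀ n c f → c * sumTo n f ≈ sumTo n (λ i → c * f i)
  sumTo-* n c f = SemiringSum.*-distribˡ-sum semiring {n} c (f ∘ toℕ)

  sumTo-0 : ∀ n → sumTo n (λ _ → 0#) ≈ 0#
  sumTo-0 n = CommutativeMonoidSum.sum-replicate-zero +-commutativeMonoid n

  sumTo-mono-≤ : ∀ n f g → (∀ i → i ℕ.< n → f i ≤ g i) → sumTo n f ≤ sumTo n g
  sumTo-mono-≤ zero    f g f≤g = ≤-refl
  sumTo-mono-≤ (suc n) f g f≤g = +-mono-≤ (f≤g 0 ℕ.z<s)
    (sumTo-mono-≤ n (f ∘ suc) (g ∘ suc) λ i i<n → f≤g (suc i) (ℕ.s<s i<n))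

  sumTo-nonneg : ∀ n f → (∀ i → 0# ≤ f i) → 0# ≤ sumTo n f
  sumTo-nonneg zero    f 0≤f = ≤-refl
  sumTo-nonneg (suc n) f 0≤f = +-nonneg (0≤f 0) (sumTo-nonneg n (f ∘ suc) (0≤f ∘ suc))

  sumTo-extend-≤ : ∀ {m n} f → m ℕ.≤ n → (∀ i → 0# ≤ f i) → sumTo m f ≤ sumTo n f
  sumTo-extend-≤ {n = n} f ℕ.z≤n 0≤f = sumTo-nonneg n f 0≤f
  sumTo-extend-≤ f (ℕ.s≤s m≤n) 0≤f =
    +-monoʳ-≤ (f 0) (sumTo-extend-≤ (f ∘ suc) m≤n (0≤f ∘ suc))

  sumTo-extend-≈ : ∀ {m n} f → m ℕ.≤ n → (∀ i → m ℕ.≤ i → f i ≈ 0#) →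
                   sumTo n f ≈ sumTo m f
  sumTo-extend-≈ {n = n} f ℕ.z≤n f≈0 =
    trans (sumTo-cong n f (λ _ → 0#) λ i _ → f≈0 i ℕ.z≤n) (sumTo-0 n)
  sumTo-extend-≈ f (ℕ.s≤s m≤n) f≈0 =
    +-congˡ (sumTo-extend-≈ (f ∘ suc) m≤n λ i m≤i → f≈0 (suc i) (ℕ.s≤s m≤i))

  -- An index `i` at or beyond `n` is never met by the sum, but then `f i` vanishes as well; this is
  -- the base case of the induction.
  sumTo-δ : ∀ n (f : ℕ → ℝ) i → (∀ j → n ℕ.≤ j → f j ≈ 0#) →
            sumTo n (λ j → f j * 𝟙 (does (i ℕ.≟ j))) ≈ f i
  sumTo-δ zero    f i       f≈0 = sym (f≈0 i ℕ.z≤n)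
  sumTo-δ (suc n) f zero    f≈0 = begin-equality
    f 0 * 1# + sumTo n (λ j → f (suc j) * 0#)
      ≈⟨ +-cong (*-identityʳ (f 0))
           (sumTo-cong n (λ j → f (suc j) * 0#) (λ _ → 0#) λ j _ → zeroʳ (f (suc j))) ⟩
    f 0 + sumTo n (λ _ → 0#) ≈⟨ +-congˡ (sumTo-0 n) ⟩
    f 0 + 0#                 ≈⟨ +-identityʳ (f 0) ⟩
    f 0                      ∎
  sumTo-δ (suc n) f (suc i) f≈0 = begin-equality
    f 0 * 0# + sumTo n (λ j → f (suc j) * 𝟙 (does (i ℕ.≟ j)))
      ≈⟨ +-cong (zeroʳ (f 0))
           (sumTo-δ n (f ∘ suc) i λ j n≤j → f≈0 (suc j) (ℕ.s≤s n≤j)) ⟩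
    0# + f (suc i) ≈⟨ +-identityˡ (f (suc i)) ⟩
    f (suc i)      ∎

  row : ℕ → (State → ℝ) → ℕ → ℝ
  row n f i = sumTo n λ j → f (i , j)

  squareSum-cong : ∀ n f g → (∀ s → InSquare n s → f s ≈ g s) →
                   squareSum f n ≈ squareSum g n
  squareSum-cong n f g f≈g = sumTo-cong n (row n f) (row n g) λ i i<n →
    sumTo-cong n (λ j → f (i , j)) (λ j → g (i , j)) λ j j<n → f≈g (i , j) (i<n , j<n)

  squareSum-mono-≤ : ∀ n f g → (∀ s → InSquare n s → f s ≤ g s) →
                     squareSum f n ≤ squareSum g n
  squareSum-mono-≤ n f g f≤g = sumTo-mono-≤ n (row n f) (row n g) λ i i<n →
    sumTo-mono-≤ n (λ j → f (i , j)) (λ j → g (i , j)) λ j j<n → f≤g (i , j) (i<n , j<n)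

  squareSum-+ : ∀ n f g → squareSum (λ s → f s + g s) n ≈ squareSum f n + squareSum g n
  squareSum-+ n f g = trans
    (sumTo-cong n (row n (λ s → f s + g s)) (λ i → row n f i + row n g i) λ i _ →
      sumTo-+ n (λ j → f (i , j)) (λ j → g (i , j)))
    (sumTo-+ n (row n f) (row n g))

  squareSum-* : ∀ n c f → c * squareSum f n ≈ squareSum (λ s → c * f s) n
  squareSum-* n c f = trans
    (sumTo-* n c (row n f))
    (sumTo-cong n (λ i → c * row n f i) (row n (λ s → c * f s)) λ i _ →
      sumTo-* n c (λ j → f (i , j)))

  squareSum-extend-≤ : ∀ {m n} f → m ℕ.≤ n → (∀ s → 0# ≤ f s) →
                       squareSum f m ≤ squareSum f n
  squareSum-extend-≤ {m} {n} f m≤n 0≤f = ≤-trans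
    (sumTo-mono-≤ m (row m f) (row n f) λ i _ →
      sumTo-extend-≤ (λ j → f (i , j)) m≤n λ j → 0≤f (i , j))
    (sumTo-extend-≤ (row n f) m≤n λ i →
      sumTo-nonneg n (λ j → f (i , j)) λ j → 0≤f (i , j))

  FiniteSupport : ℕ → (State → ℝ) → Set
  FiniteSupport N f = ∀ s → ¬ InSquare N s → f s ≈ 0#

  squareSum-extend-≈ : ∀ {m n} f → m ℕ.≤ n → FiniteSupport m f →
                       squareSum f n ≈ squareSum f m
  squareSum-extend-≈ {m} {n} f m≤n f≈0 = trans
    (sumTo-extend-≈ (row n f) m≤n λ i m≤i → trans
      (sumTo-cong n (λ j → f (i , j)) (λ _ → 0#) λ j _ →
        f≈0 (i , j) λ (i<m , _) → ℕ.<⇒≱ i<m m≤i)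
      (sumTo-0 n))
    (sumTo-cong m (row n f) (row m f) λ i _ →
      sumTo-extend-≈ (λ j → f (i , j)) m≤n λ j m≤j →
        f≈0 (i , j) λ (_ , j<m) → ℕ.<⇒≱ j<m m≤j)

  𝟙[_≡_] : State → State → ℝ
  𝟙[ s ≡ t ] = 𝟙 (does (≡-dec ℕ._≟_ ℕ._≟_ s t))

  -- The three decisions are arguments so that they can be split independently, without unfolding
  -- `≡-dec`; the inconsistent combinations are refuted.
  𝟙-pair : ∀ {h e i j : ℕ} (p : Dec ((h , e) ≡ (i , j))) (q : Dec (h ≡ i)) (r : Dec (e ≡ j)) →
           𝟙 (does p) ≈ 𝟙 (does q) * 𝟙 (does r)
  𝟙-pair (yes _)      (yes _)      (yes _)      = sym (*-identityˡ 1#)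
  𝟙-pair (no p)       (yes ≡.refl) (yes ≡.refl) = ⊥-elim (p ≡.refl)
  𝟙-pair (yes ≡.refl) (no q)       r            = ⊥-elim (q ≡.refl)
  𝟙-pair (yes ≡.refl) (yes _)      (no r)       = ⊥-elim (r ≡.refl)
  𝟙-pair (no _)       (no _)       r            = sym (zeroˡ (𝟙 (does r)))
  𝟙-pair (no _)       (yes _)      (no _)       = sym (zeroʳ 1#)

  -- The indicator of a pair is a product of two indicators, so the inner sum collapses to column
  -- `e` and the outer one to row `h`.
  squareSum-δ : ∀ N f s → FiniteSupport N f →
                squareSum (λ t → f t * 𝟙[ s ≡ t ]) N ≈ f s
  squareSum-δ N f (h , e) f≈0 = begin-equality
    sumTo N (row N (λ t → f t * 𝟙[ (h , e) ≡ t ]))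
      ≈⟨ (sumTo-cong N (row N (λ t → f t * 𝟙[ (h , e) ≡ t ])) (λ i → δ h i * row N g i) λ i _ →
           trans (sumTo-cong N (λ j → f (i , j) * 𝟙[ (h , e) ≡ (i , j) ]) (λ j → δ h i * g (i , j)) λ j _ →
                   factor i j)
                 (sym (sumTo-* N (δ h i) (λ j → g (i , j))))) ⟩
    sumTo N (λ i → δ h i * row N g i)
      ≈⟨ (sumTo-cong N (λ i → δ h i * row N g i) (λ i → f (i , e) * δ h i) λ i _ →
           trans (*-comm (δ h i) (row N g i))
             (*-congʳ (sumTo-δ N (λ j → f (i , j)) e λ j N≤j →
               f≈0 (i , j) λ (_ , j<N) → ℕ.<⇒≱ j<N N≤j))) ⟩
    sumTo N (λ i → f (i , e) * δ h i)
      ≈⟨ (sumTo-δ N (λ i → f (i , e)) h λ i N≤i →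
           f≈0 (i , e) λ (i<N , _) → ℕ.<⇒≱ i<N N≤i) ⟩
    f (h , e) ∎
    where
    δ : ℕ → ℕ → ℝ
    δ m n = 𝟙 (does (m ℕ.≟ n))
    g : State → ℝ
    g (i , j) = f (i , j) * δ e j
    factor : ∀ i j → f (i , j) * 𝟙[ (h , e) ≡ (i , j) ] ≈ δ h i * g (i , j)
    factor i j = trans
      (*-congˡ (𝟙-pair (≡-dec ℕ._≟_ ℕ._≟_ (h , e) (i , j)) (h ℕ.≟ i) (e ℕ.≟ j)))
      (solve 3 (λ x y z → x :* (y :* z) := y :* (x :* z)) refl (f (i , j)) (δ h i) (δ e j))

  -- Limits of sequences and of double series.

  Converges : (ℕ → ℝ) → ℝ → Set
  Converges a v = ∀ ε → 0# < ε → ∃[ N ] (∀ n → N ℕ.≤ n → Within ε (a n) v)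

  Converges-cong : ∀ {a b v w} → (∀ n → a n ≈ b n) → v ≈ w → Converges a v → Converges b w
  Converges-cong {a} {b} {v} {w} a≈b v≈w a→v ε 0<ε with a→v ε 0<ε
  ... | N , near = N , λ n N≤n → within
    (begin-strict
      b n     ≈⟨ a≈b n ⟨
      a n     <⟨ -<⇒<+ (proj₁ (near n N≤n)) ⟩
      v + ε   ≈⟨ +-congʳ v≈w ⟩
      w + ε   ∎)
    (begin-strict
      w       ≈⟨ v≈w ⟨
      v       <⟨ -<⇒<+ (proj₂ (near n N≤n)) ⟩
      a n + ε ≈⟨ +-congʳ (a≈b n) ⟩
      b n + ε ∎)

  Converges-const : ∀ {a v} N → (∀ n → N ℕ.≤ n → a n ≈ v) → Converges a v
  Converges-const N a≈v ε 0<ε =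
    N , λ n N≤n → within (close (a≈v n N≤n)) (close (sym (a≈v n N≤n)))
    where
    close : ∀ {x y} → x ≈ y → x < y + ε
    close {x} {y} x≈y = begin-strict
      x      ≈⟨ trans x≈y (sym (+-identityˡ y)) ⟩
      0# + y <⟨ +-monoˡ-< y 0<ε ⟩
      ε + y  ≈⟨ +-comm ε y ⟩
      y + ε  ∎

  Converges-+ : ∀ {a b v w} → Converges a v → Converges b w →
                Converges (λ n → a n + b n) (v + w)
  Converges-+ {a} {b} {v} {w} a→v b→w ε 0<ε =
    let (δ , 0<δ , δ+δ≈ε) = half 0<ε
        (M , nearM)       = a→v δ 0<δ
        (N , nearN)       = b→w δ 0<δ
    in M ℕ.⊔ N , λ n M⊔N≤n →
      let (p₁ , p₂) = nearM n (ℕ.m⊔n≤o⇒m≤o M N M⊔N≤n)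
          (q₁ , q₂) = nearN n (ℕ.m⊔n≤o⇒n≤o M N M⊔N≤n)
      in within (add δ+δ≈ε (-<⇒<+ p₁) (-<⇒<+ q₁)) (add δ+δ≈ε (-<⇒<+ p₂) (-<⇒<+ q₂))
    where
    add : ∀ {δ x y z t} → δ + δ ≈ ε → x < y + δ → z < t + δ → x + z < y + t + ε
    add {δ} {x} {y} {z} {t} δ+δ≈ε x<y+δ z<t+δ = begin-strict
      x + z           <⟨ +-mono-< x<y+δ z<t+δ ⟩
      y + δ + (t + δ) ≈⟨ interchange y δ t δ ⟩
      y + t + (δ + δ) ≈⟨ +-congˡ δ+δ≈ε ⟩
      y + t + ε       ∎

  Converges-* : ∀ {c a v} → 0# ≤ c → Converges a v → Converges (λ n → c * a n) (c * v)
  Converges-* {c} {a} {v} 0≤c a→v ε 0<ε =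
    let (δ , 0<δ , scale) = *-scale 0≤c 0<ε
        (N , near)        = a→v δ 0<δ
    in N , λ n N≤n →
      scaled scale (proj₁ (near n N≤n)) , scaled scale (proj₂ (near n N≤n))
    where
    scaled : ∀ {δ x y} → (∀ {x} → x < δ → c * x < ε) → x - y < δ → c * x - c * y < ε
    scaled {δ} {x} {y} scale x-y<δ = begin-strict
      c * x - c * y ≈⟨ x[y-z]≈xy-xz c x y ⟨
      c * (x - y)   <⟨ scale x-y<δ ⟩
      ε             ∎

  Converges-neg : ∀ {a v} → Converges a v → Converges (λ n → - a n) (- v)
  Converges-neg {a} {v} a→v ε 0<ε with a→v ε 0<ε
  ... | N , near = N , λ n N≤n →
    flipped (proj₂ (near n N≤n)) , flipped (proj₁ (near n N≤n))
    where
    flipped : ∀ {x y} → x - y < ε → - y - - x < ε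
    flipped {x} {y} x-y<ε = begin-strict
      - y - - x ≈⟨ +-congˡ (⁻¹-involutive x) ⟩
      - y + x   ≈⟨ +-comm (- y) x ⟩
      x - y     <⟨ x-y<ε ⟩
      ε         ∎

  -- `HasSum f v` unfolds to `Converges (squareSum f) v`, so the rules for sequences carry over to
  -- double series.
  HasSum-cong : ∀ {f g v w} → (∀ s → f s ≈ g s) → v ≈ w → HasSum f v → HasSum g w
  HasSum-cong {f} {g} f≈g v≈w =
    Converges-cong {squareSum f} {squareSum g} (λ n → squareSum-cong n f g λ s _ → f≈g s) v≈w

  HasSum-finite : ∀ {N} f → FiniteSupport N f → HasSum f (squareSum f N)
  HasSum-finite {N} f f≈0 =
    Converges-const {squareSum f} N λ n N≤n → squareSum-extend-≈ f N≤n f≈0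

  HasSum-0 : HasSum (λ _ → 0#) 0#
  HasSum-0 = HasSum-finite {0} (λ _ → 0#) λ _ _ → refl

  HasSum-+ : ∀ {f g v w} → HasSum f v → HasSum g w → HasSum (λ s → f s + g s) (v + w)
  HasSum-+ {f} {g} f→v g→w =
    Converges-cong {λ n → squareSum f n + squareSum g n} {squareSum λ s → f s + g s}
      (λ n → sym (squareSum-+ n f g)) refl
      (Converges-+ {squareSum f} {squareSum g} f→v g→w)

  HasSum-* : ∀ {c f v} → 0# ≤ c → HasSum f v → HasSum (λ s → c * f s) (c * v)
  HasSum-* {c} {f} 0≤c f→v =
    Converges-cong {λ n → c * squareSum f n} {squareSum λ s → c * f s}
      (λ n → squareSum-* n c f) refl (Converges-* {c} {squareSum f} 0≤c f→v)

  HasSum-neg : ∀ {f v} → HasSum f v → HasSum (λ s → - f s) (- v)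
  HasSum-neg {f} {v} f→v =
    Converges-cong {λ n → - squareSum f n} {squareSum λ s → - f s}
      (λ n → sym (squareSum-neg n)) refl (Converges-neg {squareSum f} f→v)
    where
    sumTo-neg : ∀ n g → sumTo n (λ i → - g i) ≈ - sumTo n g
    sumTo-neg zero    g = sym ε⁻¹≈ε
    sumTo-neg (suc n) g = trans (+-congˡ (sumTo-neg n (g ∘ suc)))
                                (⁻¹-∙-comm (g 0) (sumTo n (g ∘ suc)))
    squareSum-neg : ∀ n → squareSum (λ s → - f s) n ≈ - squareSum f n
    squareSum-neg n = trans
      (sumTo-cong n (row n (λ s → - f s)) (λ i → - row n f i) λ i _ →
        sumTo-neg n λ j → f (i , j))
      (sumTo-neg n (row n f))

  HasSum-sumTo : ∀ n {F : ℕ → State → ℝ} {v : ℕ → ℝ} →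
                 (∀ i → HasSum (F i) (v i)) →
                 HasSum (λ s → sumTo n λ i → F i s) (sumTo n v)
  HasSum-sumTo zero            F→v = HasSum-0
  HasSum-sumTo (suc n) {F} {v} F→v =
    HasSum-+ {F 0} {λ s → sumTo n λ i → F (suc i) s} {v 0} {sumTo n (v ∘ suc)}
      (F→v 0) (HasSum-sumTo n {F ∘ suc} {v ∘ suc} (F→v ∘ suc))

  HasSum-squareSum : ∀ n {F : State → State → ℝ} {v : State → ℝ} →
                     (∀ t → HasSum (F t) (v t)) →
                     HasSum (λ s → squareSum (λ t → F t s) n) (squareSum v n)
  HasSum-squareSum n {F} {v} F→v =
    HasSum-sumTo n {λ i s → sumTo n λ j → F (i , j) s} {row n v} λ i →
      HasSum-sumTo n {λ j → F (i , j)} {λ j → v (i , j)} λ j → F→v (i , j)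

  -- Squeezes the partial sums of `u` between bounds that both tend to `v`. From above, `u` agrees
  -- on square `n` with `π + z n`, a nonnegative series of total `v`. From below, `u - z m` is
  -- nonnegative and equals `π` on square `m`, while `z m` contributes nothing in the limit. In the
  -- application `π` is the stationary distribution, `u` the expected segment length weighted by it,
  -- and `z m` the drift of a truncated function.
  HasSum-by-truncation :
    ∀ {π u : State → ℝ} {z : ℕ → State → ℝ} {v} →
    HasSum π v → (∀ m → HasSum (z m) 0#) →
    (∀ m s → InSquare m s → u s ≈ π s + z m s) →
    (∀ m s → 0# ≤ π s + z m s) → (∀ m s → z m s ≤ u s) →
    HasSum u v
  HasSum-by-truncation {π} {u} {z} {v} π→v z→0 u≈π+z 0≤π+z z≤u ε 0<ε =
    let (δ , 0<δ , δ+δ≈ε) = half 0<ε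
        (m , π-near)      = π→v δ 0<δ
        -- The order of choice matters: `m` first captures almost all of `v`, and only then is the
        -- series `z m` fixed and summed far enough.
        (k , z-near)      = z→0 m δ 0<δ
    in m ℕ.⊔ k , λ n m⊔k≤n → within (upper n)
         (combine {a = squareSum (z m) n} {squareSum π m} {squareSum (rest m) n} {δ} {squareSum u n}
           (-<⇒<+ {δ} {0#} {squareSum (z m) n} (proj₂ (z-near n (ℕ.m⊔n≤o⇒n≤o m k m⊔k≤n))))
           (-<⇒<+ {δ} {v} {squareSum π m} (proj₂ (π-near m ℕ.≤-refl)))
           (lower (ℕ.m⊔n≤o⇒m≤o m k m⊔k≤n))
           (split m n) δ+δ≈ε)
    where
    rest : ℕ → State → ℝ
    rest m s = u s - z m s

    split : ∀ m n → squareSum (z m) n + squareSum (rest m) n ≈ squareSum u n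
    split m n = trans (sym (squareSum-+ n (z m) (rest m)))
                      (squareSum-cong n (λ s → z m s + rest m s) u λ s _ → x+[y-x]≈y (z m s) (u s))

    combine : ∀ {a p d δ t} → 0# < a + δ → v < p + δ → p ≤ d → a + d ≈ t → δ + δ ≈ ε →
              v < t + ε
    combine {a} {p} {d} {δ} {t} 0<a+δ v<p+δ p≤d a+d≈t δ+δ≈ε = begin-strict
      v                 ≈⟨ +-identityˡ v ⟨
      0# + v            <⟨ +-mono-< 0<a+δ v<p+δ ⟩
      a + δ + (p + δ)   ≤⟨ +-monoʳ-≤ (a + δ) (+-monoˡ-≤ δ p≤d) ⟩
      a + δ + (d + δ)   ≈⟨ solve 3 (λ a d e → a :+ e :+ (d :+ e) := a :+ d :+ (e :+ e)) refl a d δ ⟩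
      a + d + (δ + δ)   ≈⟨ +-cong a+d≈t δ+δ≈ε ⟩
      t + ε             ∎

    upper : ∀ n → squareSum u n < v + ε
    upper n =
      -- The truncation index stays at `n` while the square grows to `n ℕ.⊔ k`, where the sum of
      -- `π + z n` is close to its limit. Enlarging the square only adds nonnegative terms.
      let (k , near) = HasSum-+ {π} {z n} {v} {0#} π→v (z→0 n) ε 0<ε
      in begin-strict
      squareSum u n
        ≈⟨ squareSum-cong n u (λ s → π s + z n s) (u≈π+z n) ⟩
      squareSum (λ s → π s + z n s) n
        ≤⟨ squareSum-extend-≤ (λ s → π s + z n s) (ℕ.m≤m⊔n n k) (0≤π+z n) ⟩
      squareSum (λ s → π s + z n s) (n ℕ.⊔ k)
        <⟨ -<⇒<+ (proj₁ (near (n ℕ.⊔ k) (ℕ.m≤n⊔m n k))) ⟩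
      v + 0# + ε
        ≈⟨ +-congʳ (+-identityʳ v) ⟩
      v + ε ∎

    lower : ∀ {m n} → m ℕ.≤ n → squareSum π m ≤ squareSum (rest m) n
    lower {m} {n} m≤n = begin
      -- On square `m` the remainder equals `π`; outside it the remainder is merely nonnegative,
      -- which is enough to extend the sum to `n`.
      squareSum π m        ≤⟨ squareSum-mono-≤ m π (rest m) (λ s s∈m →
                                +-≤⇒≤-- (≤-reflexive (sym (u≈π+z m s s∈m)))) ⟩
      squareSum (rest m) m ≤⟨ squareSum-extend-≤ (rest m) m≤n (λ s → x≤y⇒0≤y-x (z≤u m s)) ⟩
      squareSum (rest m) n ∎

-- Market size and truncated subtraction.

size : State → ℕ
size (h , e) = h ℕ.+ e

size<⇒InSquare : ∀ {n} s → size s ℕ.< n → InSquare n s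
size<⇒InSquare (h , e) h+e<n =
  ℕ.≤-<-trans (ℕ.m≤m+n h e) h+e<n , ℕ.≤-<-trans (ℕ.m≤n+m e h) h+e<n

-- Explains the truncation level `m ℕ.+ m` used below: it exceeds the size of every state of square
-- `m`.
InSquare⇒size< : ∀ {n} s → InSquare n s → size s ℕ.< n ℕ.+ n
InSquare⇒size< (h , e) (h<n , e<n) = ℕ.+-mono-< h<n e<n

segmentLength≡ : ∀ s s′ → size s′ ℕ.≤ suc (size s) →
                 segmentLength s s′ ≡ + (suc (size s) ℕ.∸ size s′)
segmentLength≡ s s′ = ℤ.⊖-≥

-- Here and in the next two lemmas `m` and `n` stand for the sizes before and after a step and `o`
-- for the truncation level. Below the level, the increment of the deficit is the segment length
-- minus one, written additively to stay within the naturals.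
[1+m∸n]+[o∸m]≡1+[o∸n] : ∀ {m n o} → n ℕ.≤ suc m → m ℕ.< o →
                        (suc m ℕ.∸ n) ℕ.+ (o ℕ.∸ m) ≡ suc (o ℕ.∸ n)
[1+m∸n]+[o∸m]≡1+[o∸n] {m} {n} {suc o} n≤1+m (ℕ.s≤s m≤o) = begin
  (suc m ℕ.∸ n) ℕ.+ (suc o ℕ.∸ m)       ≡⟨ ≡.cong ((suc m ℕ.∸ n) ℕ.+_) (ℕ.+-∸-assoc 1 m≤o) ⟩
  (suc m ℕ.∸ n) ℕ.+ suc (o ℕ.∸ m)       ≡⟨ ℕ.+-suc (suc m ℕ.∸ n) (o ℕ.∸ m) ⟩
  suc ((suc m ℕ.∸ n) ℕ.+ (o ℕ.∸ m))     ≡⟨ ≡.cong suc (ℕ.+-∸-comm (o ℕ.∸ m) n≤1+m) ⟨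
  suc (suc m ℕ.+ (o ℕ.∸ m) ℕ.∸ n)       ≡⟨ ≡.cong (λ k → suc (suc k ℕ.∸ n)) (ℕ.m+[n∸m]≡n m≤o) ⟩
  suc (suc o ℕ.∸ n)                     ∎
  where open ≡.≡-Reasoning

-- At most one agent joins per step, so the deficit drops by at most one, on either side of the
-- level.
o∸m≤1+[o∸n] : ∀ {m n} o → n ℕ.≤ suc m → o ℕ.∸ m ℕ.≤ suc (o ℕ.∸ n)
o∸m≤1+[o∸n] {m} {n} o n≤1+m = begin
  o ℕ.∸ m                    ≤⟨ ℕ.m≤n+m∸n (o ℕ.∸ m) 1 ⟩
  suc (o ℕ.∸ m ℕ.∸ 1)        ≡⟨ ≡.cong suc (ℕ.∸-+-assoc o m 1) ⟩
  suc (o ℕ.∸ (m ℕ.+ 1))      ≤⟨ ℕ.s≤s (ℕ.∸-monoʳ-≤ o (≡.subst (n ℕ.≤_) (ℕ.+-comm 1 m) n≤1+m)) ⟩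
  suc (o ℕ.∸ n)              ∎
  where open ℕ.≤-Reasoning

-- The deficit grows by at most the segment length, on either side of the level: subtract `n` from
-- `o ≤ suc m + (o ∸ m)`.
o∸n≤[1+m∸n]+[o∸m] : ∀ {m n} o → n ℕ.≤ suc m →
                    o ℕ.∸ n ℕ.≤ (suc m ℕ.∸ n) ℕ.+ (o ℕ.∸ m)
o∸n≤[1+m∸n]+[o∸m] {m} {n} o n≤1+m = begin
  o ℕ.∸ n                           ≤⟨ ℕ.∸-monoˡ-≤ n (ℕ.m≤n⇒m≤1+n (ℕ.m≤n+m∸n o m)) ⟩
  suc m ℕ.+ (o ℕ.∸ m) ℕ.∸ n         ≡⟨ ℕ.+-∸-comm (o ℕ.∸ m) n≤1+m ⟩
  (suc m ℕ.∸ n) ℕ.+ (o ℕ.∸ m)       ∎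
  where open ℕ.≤-Reasoning

-- Expectations over finite random experiments.

module Expectation (R : RealField) where
  open RealField R
  open Analysis R
  open OrderedField R
  open Summation R
  open PartialOrderReasoning poset
  open SemiringMult semiring using (×-homo-+)
  open AbelianGroupProperties +-abelianGroup using (//-rightDividesʳ)
  open RingProperties ring using (-‿distribʳ-*)
  open SemiringSolver commutativeSemiring using (solve; _:=_; _:+_; _:*_)

  Probability : ℝ → Set
  Probability p = 0# ≤ p × p ≤ 1#

  private variable
    A B : Set

  -- The biases are constrained as well, since flip accepts any real number and 𝔼
  -- is monotone only for genuine probabilities.
  Always : (A → Set) → Random A → Set
  Always P (return a)   = P a
  Always P (flip p x y) = Probability p × Always P x × Always P y

  Always->>= : ∀ {P : A → Set} {Q : B → Set} {k} x → Always P x →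
               (∀ a → P a → Always Q (k a)) → Always Q (x >>= k)
  Always->>= (return a)   Pa           P⇒Q = P⇒Q a Pa
  Always->>= (flip p x y) (p∈ , X , Y) P⇒Q =
    p∈ , Always->>= x X P⇒Q , Always->>= y Y P⇒Q

  Always-map : ∀ {P Q : A → Set} x → (∀ a → P a → Q a) → Always P x → Always Q x
  Always-map (return a)   P⇒Q Pa           = P⇒Q a Pa
  Always-map (flip p x y) P⇒Q (p∈ , X , Y) = p∈ , Always-map x P⇒Q X , Always-map y P⇒Q Y

  Always-if : ∀ {P : A → Set} {x y} b →
              Always P x → Always P y → Always P (if b then x else y)
  Always-if true  X Y = X
  Always-if false X Y = Y

  𝔼->>= : ∀ (x : Random A) (k : A → Random B) f → 𝔼 (x >>= k) f ≈ 𝔼 x (λ a → 𝔼 (k a) f)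
  𝔼->>= (return a)   k f = refl
  𝔼->>= (flip p x y) k f = +-cong (*-congˡ (𝔼->>= x k f)) (*-congˡ (𝔼->>= y k f))

  𝔼-cong : ∀ (x : Random A) {P f g} → Always P x → (∀ a → P a → f a ≈ g a) → 𝔼 x f ≈ 𝔼 x g
  𝔼-cong (return a)   Pa          f≈g = f≈g a Pa
  𝔼-cong (flip p x y) (_ , X , Y) f≈g =
    +-cong (*-congˡ (𝔼-cong x X f≈g)) (*-congˡ (𝔼-cong y Y f≈g))

  𝔼-mono-≤ : ∀ (x : Random A) {P f g} → Always P x → (∀ a → P a → f a ≤ g a) → 𝔼 x f ≤ 𝔼 x g
  𝔼-mono-≤ (return a)   Pa                    f≤g = f≤g a Pa
  𝔼-mono-≤ (flip p x y) ((0≤p , p≤1) , X , Y) f≤g = +-mono-≤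
    (*-monoˡ-≤ 0≤p (𝔼-mono-≤ x X f≤g))
    (*-monoˡ-≤ (x≤y⇒0≤y-x p≤1) (𝔼-mono-≤ y Y f≤g))

  𝔼-+ : ∀ (x : Random A) f g → 𝔼 x (λ a → f a + g a) ≈ 𝔼 x f + 𝔼 x g
  𝔼-+ (return a)   f g = refl
  𝔼-+ (flip p x y) f g = trans
    (+-cong (*-congˡ (𝔼-+ x f g)) (*-congˡ (𝔼-+ y f g)))
    (solve 6 (λ p r a b c d → p :* (a :+ b) :+ r :* (c :+ d) :=
                              (p :* a :+ r :* c) :+ (p :* b :+ r :* d))
      refl p (1# - p) (𝔼 x f) (𝔼 x g) (𝔼 y f) (𝔼 y g))

  𝔼-* : ∀ (x : Random A) c f → 𝔼 x (λ a → c * f a) ≈ c * 𝔼 x f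
  𝔼-* (return a)   c f = refl
  𝔼-* (flip p x y) c f = trans
    (+-cong (*-congˡ (𝔼-* x c f)) (*-congˡ (𝔼-* y c f)))
    (solve 5 (λ p r c a b → p :* (c :* a) :+ r :* (c :* b) := c :* (p :* a :+ r :* b))
      refl p (1# - p) c (𝔼 x f) (𝔼 y f))

  𝔼-const : ∀ (x : Random A) c → 𝔼 x (λ _ → c) ≈ c
  𝔼-const (return a)   c = refl
  𝔼-const (flip p x y) c = begin-equality
    p * 𝔼 x (λ _ → c) + (1# - p) * 𝔼 y (λ _ → c)
      ≈⟨ +-cong (*-congˡ (𝔼-const x c)) (*-congˡ (𝔼-const y c)) ⟩
    p * c + (1# - p) * c ≈⟨ distribʳ c p (1# - p) ⟨
    (p + (1# - p)) * c   ≈⟨ *-congʳ (x+[y-x]≈y p 1#) ⟩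
    1# * c               ≈⟨ *-identityˡ c ⟩
    c                    ∎

  𝔼-sumTo : ∀ (x : Random A) n (f : ℕ → A → ℝ) →
            𝔼 x (λ a → sumTo n λ i → f i a) ≈ sumTo n (λ i → 𝔼 x (f i))
  𝔼-sumTo x zero    f = 𝔼-const x 0#
  𝔼-sumTo x (suc n) f = trans
    (𝔼-+ x (f 0) (λ a → sumTo n λ i → f (suc i) a))
    (+-congˡ (𝔼-sumTo x n (f ∘ suc)))

  𝔼-squareSum : ∀ (x : Random A) n (f : State → A → ℝ) →
                𝔼 x (λ a → squareSum (λ t → f t a) n) ≈ squareSum (λ t → 𝔼 x (f t)) n
  𝔼-squareSum x n f = trans
    (𝔼-sumTo x n λ i a → sumTo n λ j → f (i , j) a)
    (sumTo-cong n (λ i → 𝔼 x λ a → sumTo n λ j → f (i , j) a)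
      (row n λ t → 𝔼 x (f t)) λ i _ → 𝔼-sumTo x n λ j → f (i , j))

  -- Writes `φ` as a finite combination of indicators and exchanges that finite sum with the
  -- expectation. This brings in `transition`, the only form in which invariance is given.
  𝔼-transition : ∀ (K : Kernel) {N P} φ s → FiniteSupport N φ → Always P (K s) →
                 𝔼 (K s) φ ≈ squareSum (λ t → φ t * transition K s t) N
  𝔼-transition K {N} φ s φ-finite always = begin-equality
    𝔼 (K s) φ
      ≈⟨ 𝔼-cong (K s) always (λ s′ _ → sym (squareSum-δ N φ s′ φ-finite)) ⟩
    𝔼 (K s) (λ s′ → squareSum (λ t → φ t * 𝟙[ s′ ≡ t ]) N)
      ≈⟨ 𝔼-squareSum (K s) N (λ t s′ → φ t * 𝟙[ s′ ≡ t ]) ⟩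
    squareSum (λ t → 𝔼 (K s) (λ s′ → φ t * 𝟙[ s′ ≡ t ])) N
      ≈⟨ squareSum-cong N (λ t → 𝔼 (K s) (λ s′ → φ t * 𝟙[ s′ ≡ t ]))
           (λ t → φ t * transition K s t) (λ t _ → 𝔼-* (K s) (φ t) 𝟙[_≡ t ]) ⟩
    squareSum (λ t → φ t * transition K s t) N ∎

  -- The size bound makes the length a natural number, and the indicator discards only the value
  -- zero, which contributes nothing to the mean.
  length-matched : ∀ s s′ → size s′ ℕ.≤ suc (size s) →
                   fromℤ (segmentLength s s′) * matched s s′ ≈ (suc (size s) ℕ.∸ size s′) ×ᴿ 1#
  length-matched s s′ s′≤1+s rewrite segmentLength≡ s s′ s′≤1+s
    with suc (size s) ℕ.∸ size s′
  ... | zero  = zeroˡ 0#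
  ... | suc n = *-identityʳ (1# + n ×ᴿ 1#)

  matched-smaller : ∀ s s′ → size s′ ℕ.≤ size s → matched s s′ ≈ 1#
  matched-smaller s s′ s′≤s
    rewrite segmentLength≡ s s′ (ℕ.m≤n⇒m≤1+n s′≤s) | ℕ.+-∸-assoc 1 s′≤s = refl

  matched-larger : ∀ s s′ → size s′ ≡ suc (size s) → matched s s′ ≈ 0#
  matched-larger s s′ eq
    rewrite segmentLength≡ s s′ (ℕ.≤-reflexive eq) | eq | ℕ.n∸n≡0 (size s) = refl

  -- Stationary chains that grow by at most one agent per step.

  module Stationary (K : Kernel) (π : State → ℝ) (stationary : IsStationary K π)
                    (K-size : ∀ s → Always (λ s′ → size s′ ℕ.≤ suc (size s)) (K s)) where
    open IsStationary stationary renaming (total to total-mass)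

    drift : (State → ℝ) → State → ℝ
    drift φ s = π s * 𝔼 (K s) (λ s′ → φ s′ - φ s)

    -- Finite support reduces the interchange of sums to finitely many uses of `invariant`, one for
    -- each target `t`, scaled by `φ t`. The expected value of `φ` after a step and the one before
    -- it are then the same finite sum, and they cancel.
    HasSum-drift : ∀ {N} φ → (∀ s → 0# ≤ φ s) → FiniteSupport N φ → HasSum (drift φ) 0#
    HasSum-drift {N} φ 0≤φ φ-finite = HasSum-cong pointwise (-‿inverseʳ total-φ)
      (HasSum-+ {λ s → squareSum (λ t → φ t * (π s * transition K s t)) N} {λ s → - (φ s * π s)}
        (HasSum-squareSum N {λ t s → φ t * (π s * transition K s t)} {λ t → φ t * π t}
          λ t → HasSum-* {φ t} {λ s → π s * transition K s t} (0≤φ t) (invariant t))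
        -- The subtracted series is finitely supported, so its partial sums are eventually equal to
        -- `total-φ`.
        (HasSum-neg {λ s → φ s * π s}
          (HasSum-finite (λ s → φ s * π s) λ s s∉N →
            trans (*-congʳ (φ-finite s s∉N)) (zeroˡ (π s)))))
      where
      total-φ = squareSum (λ s → φ s * π s) N
      pointwise : ∀ s → squareSum (λ t → φ t * (π s * transition K s t)) N + - (φ s * π s)
                        ≈ drift φ s
      pointwise s = begin-equality
        squareSum (λ t → φ t * (π s * transition K s t)) N + - (φ s * π s)
          ≈⟨ +-cong
               (squareSum-cong N (λ t → φ t * (π s * transition K s t))
                 (λ t → π s * (φ t * transition K s t)) λ t _ →
                   solve 3 (λ a b c → a :* (b :* c) := b :* (a :* c)) refl
                     (φ t) (π s) (transition K s t))
               (trans (-‿cong (*-comm (φ s) (π s))) (-‿distribʳ-* (π s) (φ s))) ⟩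
        squareSum (λ t → π s * (φ t * transition K s t)) N + π s * - φ s
          ≈⟨ +-congʳ (squareSum-* N (π s) (λ t → φ t * transition K s t)) ⟨
        π s * squareSum (λ t → φ t * transition K s t) N + π s * - φ s
          ≈⟨ +-cong (*-congˡ (𝔼-transition K φ s φ-finite (K-size s)))
                    (*-congˡ (𝔼-const (K s) (- φ s))) ⟨
        π s * 𝔼 (K s) φ + π s * 𝔼 (K s) (λ _ → - φ s)
          ≈⟨ distribˡ (π s) (𝔼 (K s) φ) (𝔼 (K s) (λ _ → - φ s)) ⟨
        π s * (𝔼 (K s) φ + 𝔼 (K s) (λ _ → - φ s))
          ≈⟨ *-congˡ (𝔼-+ (K s) φ (λ _ → - φ s)) ⟨
        drift φ s ∎

    deficit : ℕ → State → ℝ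
    deficit N s = (N ℕ.∸ size s) ×ᴿ 1#

    deficit-finite : ∀ N → FiniteSupport N (deficit N)
    deficit-finite N s s∉N
      rewrite ℕ.m≤n⇒m∸n≡0 (ℕ.≮⇒≥ (s∉N ∘ size<⇒InSquare s)) = refl

    -- Applies the truncation lemma to the drifts of the deficits at levels `m ℕ.+ m`; its three
    -- pointwise hypotheses are `inside`, `below` and `above`, averaged over a step and weighted by
    -- `π s`.
    HasExpectation-segmentLength :
      HasExpectation K π (λ s s′ → fromℤ (segmentLength s s′) * matched s s′) 1#
    HasExpectation-segmentLength = HasSum-by-truncation {π} {λ s → π s * 𝔼 (K s) (ℓ s)}
      {λ m → drift (deficit (m ℕ.+ m))} total-mass
      (λ m → HasSum-drift (deficit (m ℕ.+ m)) (λ s → ×1-nonneg (m ℕ.+ m ℕ.∸ size s))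
        (deficit-finite (m ℕ.+ m)))
      (λ m s s∈m → trans
        (*-congˡ (𝔼-cong (K s) (K-size s) (inside (m ℕ.+ m) s (InSquare⇒size< s s∈m))))
        (π+drift (m ℕ.+ m) s))
      (λ m s → ≤-respʳ-≈ (π+drift (m ℕ.+ m) s) (*-nonneg (nonneg s)
        (≤-respˡ-≈ (𝔼-const (K s) 0#) (𝔼-mono-≤ (K s) (K-size s) (below (m ℕ.+ m) s)))))
      (λ m s → *-monoˡ-≤ (nonneg s) (𝔼-mono-≤ (K s) (K-size s) (above (m ℕ.+ m) s)))
      where
      ℓ : State → State → ℝ
      ℓ s s′ = fromℤ (segmentLength s s′) * matched s s′

      Δ : ℕ → State → State → ℝ
      Δ N s s′ = deficit N s′ - deficit N s

      π+drift : ∀ N s → π s * 𝔼 (K s) (λ s′ → 1# + Δ N s s′) ≈ π s + drift (deficit N) s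
      π+drift N s = begin-equality
        π s * 𝔼 (K s) (λ s′ → 1# + Δ N s s′)
          ≈⟨ *-congˡ (𝔼-+ (K s) (λ _ → 1#) (Δ N s)) ⟩
        π s * (𝔼 (K s) (λ _ → 1#) + 𝔼 (K s) (Δ N s))
          ≈⟨ *-congˡ (+-congʳ (𝔼-const (K s) 1#)) ⟩
        π s * (1# + 𝔼 (K s) (Δ N s))
          ≈⟨ distribˡ (π s) 1# (𝔼 (K s) (Δ N s)) ⟩
        π s * 1# + drift (deficit N) s
          ≈⟨ +-congʳ (*-identityʳ (π s)) ⟩
        π s + drift (deficit N) s ∎

      -- The strict bound on `size s` forces `size s′` to be at most `N`, so neither deficit is cut
      -- off at zero.
      inside : ∀ N s → size s ℕ.< N → ∀ s′ → size s′ ℕ.≤ suc (size s) →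
               ℓ s s′ ≈ 1# + Δ N s s′
      inside N s s<N s′ s′≤1+s = begin-equality
        ℓ s s′                              ≈⟨ length-matched s s′ s′≤1+s ⟩
        k ×ᴿ 1#                             ≈⟨ //-rightDividesʳ (deficit N s) (k ×ᴿ 1#) ⟨
        k ×ᴿ 1# + deficit N s - deficit N s ≈⟨ +-congʳ (×-homo-+ 1# k (N ℕ.∸ size s)) ⟨
        (k ℕ.+ (N ℕ.∸ size s)) ×ᴿ 1# - deficit N s
          ≡⟨ ≡.cong (λ n → n ×ᴿ 1# - deficit N s) ([1+m∸n]+[o∸m]≡1+[o∸n] s′≤1+s s<N) ⟩
        1# + deficit N s′ - deficit N s     ≈⟨ +-assoc 1# (deficit N s′) (- deficit N s) ⟩
        1# + Δ N s s′                       ∎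
        where k = suc (size s) ℕ.∸ size s′

      below : ∀ N s s′ → size s′ ℕ.≤ suc (size s) → 0# ≤ 1# + Δ N s s′
      below N s s′ s′≤1+s = ≤-respʳ-≈ (+-assoc 1# (deficit N s′) (- deficit N s))
        (x≤y⇒0≤y-x (×1-mono-≤ (o∸m≤1+[o∸n] N s′≤1+s)))

      above : ∀ N s s′ → size s′ ℕ.≤ suc (size s) → Δ N s s′ ≤ ℓ s s′
      above N s s′ s′≤1+s = ≤-+⇒--≤ (begin
        deficit N s′                    ≤⟨ ×1-mono-≤ (o∸n≤[1+m∸n]+[o∸m] N s′≤1+s) ⟩
        (k ℕ.+ (N ℕ.∸ size s)) ×ᴿ 1#    ≈⟨ ×-homo-+ 1# k (N ℕ.∸ size s) ⟩
        k ×ᴿ 1# + deficit N s           ≈⟨ +-congʳ (length-matched s s′ s′≤1+s) ⟨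
        ℓ s s′ + deficit N s            ∎)
        where k = suc (size s) ℕ.∸ size s′

    HasExpectation-const : ∀ {f c} → 0# ≤ c → (∀ s → 𝔼 (K s) (f s) ≈ c) →
                           HasExpectation K π f c
    HasExpectation-const {f} {c} 0≤c f≈c = HasSum-cong
      {λ s → c * π s} {λ s → π s * 𝔼 (K s) (f s)}
      (λ s → trans (*-comm c (π s)) (*-congˡ (sym (f≈c s)))) (*-identityʳ c)
      (HasSum-* {c} {π} 0≤c total-mass)

-- The probability that some edge is present.

module ChainAnalysis (R : RealField) where
  open RealField R
  open Analysis R
  open OrderedField R
  open Expectation R
  open PartialOrderReasoning poset
  open NonStrictToStrict _≈_ _≤_ using (<⇒≤)
  open AbelianGroupProperties +-abelianGroup using (//-rightDividesʳ)
  open SemiringSolver commutativeSemiring using (solve; _:=_; _:+_; _:*_; con)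

  1-p-probability : ∀ {p} → Probability p → Probability (1# - p)
  1-p-probability {p} (0≤p , p≤1) = x≤y⇒0≤y-x p≤1 , ≤-+⇒--≤ (begin
    1#      ≈⟨ +-identityʳ 1# ⟨
    1# + 0# ≤⟨ +-monoʳ-≤ 1# 0≤p ⟩
    1# + p  ∎)

  -- This is `1# - (1# - q) ^ n`, the probability of at least one success in `n` independent trials.
  -- The recursion on the first trial mirrors `anyEdge` and makes the sign evident.
  hit : ℕ → ℝ → ℝ
  hit zero    q = 0#
  hit (suc n) q = q + (1# - q) * hit n q

  hit+miss : ∀ n q → hit n q + (1# - q) ^ n ≈ 1#
  hit+miss zero    q = +-identityˡ 1#
  hit+miss (suc n) q = begin-equality
    q + r * hit n q + r * r ^ n ≈⟨ solve 4 (λ q r h m → q :+ r :* h :+ r :* m := q :+ r :* (h :+ m)) refl q r (hit n q) (r ^ n) ⟩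
    q + r * (hit n q + r ^ n)   ≈⟨ +-congˡ (trans (*-congˡ (hit+miss n q)) (*-identityʳ r)) ⟩
    q + r                       ≈⟨ x+[y-x]≈y q 1# ⟩
    1#                          ∎
    where r = 1# - q

  1-miss≈hit : ∀ n q → 1# - (1# - q) ^ n ≈ hit n q
  1-miss≈hit n q = trans (+-congʳ (sym (hit+miss n q))) (//-rightDividesʳ ((1# - q) ^ n) (hit n q))

  hit-nonneg : ∀ n {q} → Probability q → 0# ≤ hit n q
  hit-nonneg zero    q∈ = ≤-refl
  hit-nonneg (suc n) q∈ = +-nonneg (proj₁ q∈)
    (*-nonneg (proj₁ (1-p-probability q∈)) (hit-nonneg n q∈))

  hit-pos : ∀ {n q} → 1 ℕ.≤ n → 0# < q → Probability q → 0# < hit n q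
  hit-pos {suc n} _ 0<q q∈ = +-pos 0<q
    (*-nonneg (proj₁ (1-p-probability q∈)) (hit-nonneg n q∈))

  -- The union bound; it makes the contribution of `H` arrivals vanish linearly in `pH`.
  hit≤n*q : ∀ n {q} → Probability q → hit n q ≤ n ×ᴿ 1# * q
  hit≤n*q zero    {q} q∈ = ≤-reflexive (sym (zeroˡ q))
  hit≤n*q (suc n) {q} q∈ = begin
    q + (1# - q) * hit n q ≤⟨ +-monoʳ-≤ q (*-monoʳ-≤ (hit-nonneg n q∈) (proj₂ (1-p-probability q∈))) ⟩
    q + 1# * hit n q       ≈⟨ +-congˡ (*-identityˡ (hit n q)) ⟩
    q + hit n q            ≤⟨ +-monoʳ-≤ q (hit≤n*q n q∈) ⟩
    q + n ×ᴿ 1# * q        ≈⟨ +-congʳ (*-identityˡ q) ⟨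
    1# * q + n ×ᴿ 1# * q   ≈⟨ distribʳ q 1# (n ×ᴿ 1#) ⟨
    (1# + n ×ᴿ 1#) * q     ∎

  -- The match probability and the limit of its reciprocal.

  module Chain (λH λE pE : ℝ) (0<λH : 0# < λH) (0<λE : 0# < λE)
               (0<pE : 0# < pE) (pE≤1 : pE ≤ 1#) (d : ℕ) where

    qH : ℝ
    qH = λH / (λH + λE)

    0<λH+λE : 0# < λH + λE
    0<λH+λE = +-pos 0<λH (<⇒≤ 0<λE)

    1-qH≈ : 1# - qH ≈ λE * (λH + λE) ⁻¹
    1-qH≈ = begin-equality
      1# - qH                              ≈⟨ +-congʳ (inverseʳ 0<λH+λE) ⟨
      (λH + λE) * i - λH * i               ≈⟨ +-congʳ (solve 3 (λ a b i → (a :+ b) :* i := b :* i :+ a :* i) refl λH λE i) ⟩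
      λE * i + λH * i - λH * i             ≈⟨ //-rightDividesʳ (λH * i) (λE * i) ⟩
      λE * i                               ∎
      where i = (λH + λE) ⁻¹

    0<1-qH : 0# < 1# - qH
    0<1-qH = begin-strict
      0#                   <⟨ *-pos 0<λE (⁻¹-pos 0<λH+λE) ⟩
      λE * (λH + λE) ⁻¹    ≈⟨ 1-qH≈ ⟨
      1# - qH              ∎

    0≤qH : 0# ≤ qH
    0≤qH = <⇒≤ (*-pos 0<λH (⁻¹-pos 0<λH+λE))

    qH-probability : Probability qH
    qH-probability = 0≤qH , (begin
      qH               ≈⟨ +-identityʳ qH ⟨
      qH + 0#          ≤⟨ +-monoʳ-≤ qH (<⇒≤ 0<1-qH) ⟩
      qH + (1# - qH)   ≈⟨ x+[y-x]≈y qH 1# ⟩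
      1#               ∎)

    pE-probability : Probability pE
    pE-probability = <⇒≤ 0<pE , pE≤1

    -- The share of the match probability due to `E` arrivals, which is also the limit of the whole
    -- as `pH` tends to zero.
    matchE : ℝ
    matchE = (1# - qH) * hit d pE

    matchProbability : ℝ → ℝ
    matchProbability pH = qH * hit d pH + matchE

    0<matchE : 1 ℕ.≤ d → 0# < matchE
    0<matchE 1≤d = *-pos 0<1-qH (hit-pos 1≤d 0<pE pE-probability)

    matchE≤matchProbability : ∀ {pH} → Probability pH → matchE ≤ matchProbability pH
    matchE≤matchProbability {pH} pH∈ = begin
      matchE                   ≈⟨ +-identityˡ matchE ⟨
      0# + matchE              ≤⟨ +-monoˡ-≤ matchE (*-nonneg 0≤qH (hit-nonneg d pH∈)) ⟩
      matchProbability pH      ∎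

    0<matchProbability : ∀ {pH} → 1 ℕ.≤ d → Probability pH → 0# < matchProbability pH
    0<matchProbability {pH} 1≤d pH∈ = begin-strict
      0#                    <⟨ 0<matchE 1≤d ⟩
      matchE                ≤⟨ matchE≤matchProbability pH∈ ⟩
      matchProbability pH   ∎

    limit : ℝ
    limit = (λH + λE * (1# - pE) ^ d) / (λE * (1# - (1# - pE) ^ d)) + 1#

    limit≈matchE⁻¹ : 1 ℕ.≤ d → limit ≈ matchE ⁻¹
    limit≈matchE⁻¹ 1≤d = *-cancelˡ-≈ (0<matchE 1≤d) (begin-equality
      matchE * ((λH + λE * m) * y + 1#)
        ≈⟨ *-congʳ (*-cong 1-qH≈ (sym (1-miss≈hit d pE))) ⟩
      λE * i * c * ((λH + λE * m) * y + 1#)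
        -- Groups `λE * c * y`, which equals one because `y` is the inverse of `λE * c`.
        ≈⟨ solve 6 (λ a b i c m y → b :* i :* c :* ((a :+ b :* m) :* y :+ con 1) :=
                     i :* ((a :+ b :* m) :* (b :* c :* y) :+ b :* c))
             refl λH λE i c m y ⟩
      i * ((λH + λE * m) * (λE * c * y) + λE * c)
        ≈⟨ *-congˡ (+-congʳ (trans (*-congˡ (inverseʳ 0<λE*c)) (*-identityʳ _))) ⟩
      i * (λH + λE * m + λE * c)
        ≈⟨ solve 5 (λ a b i c m → i :* (a :+ b :* m :+ b :* c) := i :* (a :+ b :* (m :+ c)))
             refl λH λE i c m ⟩
      i * (λH + λE * (m + c))
        -- The miss and hit probabilities `m` and `c` add up to one, leaving the total arrival rate,
        -- which `i` inverts.
        ≈⟨ *-congˡ (+-congˡ (trans (*-congˡ (x+[y-x]≈y m 1#)) (*-identityʳ λE))) ⟩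
      i * (λH + λE)
        ≈⟨ trans (*-comm i (λH + λE)) (inverseʳ 0<λH+λE) ⟩
      1#
        ≈⟨ inverseʳ (0<matchE 1≤d) ⟨
      matchE * matchE ⁻¹ ∎)
      where
      i = (λH + λE) ⁻¹
      m = (1# - pE) ^ d
      c = 1# - m
      y = (λE * c) ⁻¹
      0<λE*c : 0# < λE * c
      0<λE*c = *-pos 0<λE (begin-strict
        0#       <⟨ hit-pos 1≤d 0<pE pE-probability ⟩
        hit d pE ≈⟨ 1-miss≈hit d pE ⟨
        c        ∎)

    Limit0⁺-matchProbability⁻¹ : 1 ℕ.≤ d → Limit0⁺ (λ pH → 1# / matchProbability pH) limit
    Limit0⁺-matchProbability⁻¹ 1≤d ε 0<ε =
      let 0<b = 0<matchE 1≤d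
          -- The tolerance `ε * (matchE * matchE)` is the gap between the match probability and
          -- `matchE` that `⁻¹-within` allows.
          (δ , 0<δ , scale) = *-scale (*-nonneg 0≤qH (×1-nonneg d))
                                      (*-pos 0<ε (*-pos 0<b 0<b))
          -- The bound by one ensures that every `pH` below `η` is a probability.
          (η , 0<η , η≤δ , η≤1) = min-pos 0<δ 0<1
      in η , 0<η , λ pH 0<pH pH<η →
        near pH (<⇒≤ 0<pH , ≤-trans (<⇒≤ pH<η) η≤1)
          (scale (begin-strict
            pH <⟨ pH<η ⟩
            η  ≤⟨ η≤δ ⟩
            δ  ∎))
      where
      near : ∀ pH → Probability pH → qH * (d ×ᴿ 1#) * pH < ε * (matchE * matchE) →
             Within ε (1# / matchProbability pH) limit
      near pH pH∈ small =
        let (p , q) = ⁻¹-within 0<ε (0<matchE 1≤d) (matchE≤matchProbability pH∈) (begin-strict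
              qH * hit d pH + matchE            ≤⟨ +-monoˡ-≤ matchE (*-monoˡ-≤ 0≤qH (hit≤n*q d pH∈)) ⟩
              qH * (d ×ᴿ 1# * pH) + matchE      ≈⟨ +-congʳ (*-assoc qH (d ×ᴿ 1#) pH) ⟨
              qH * (d ×ᴿ 1#) * pH + matchE      <⟨ +-monoˡ-< matchE small ⟩
              ε * (matchE * matchE) + matchE    ≈⟨ +-comm _ matchE ⟩
              matchE + ε * (matchE * matchE)    ∎)
            y≈ = limit≈matchE⁻¹ 1≤d
            x≈ = *-identityˡ (matchProbability pH ⁻¹)
        in (begin-strict
             1# / matchProbability pH - limit    ≈⟨ +-cong x≈ (-‿cong y≈) ⟩
             matchProbability pH ⁻¹ - matchE ⁻¹  <⟨ p ⟩
             ε                                   ∎)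
         , (begin-strict
             limit - 1# / matchProbability pH    ≈⟨ +-cong y≈ (-‿cong x≈) ⟩
             matchE ⁻¹ - matchProbability pH ⁻¹  <⟨ q ⟩
             ε                                   ∎)

    -- Sizes and match probabilities along a ChainMatch step.

    module _ (pH : ℝ) (pH∈ : Probability pH) where
      open ChainMatch R λH λE pE d pH

      p-probability : ∀ T → Probability (p T)
      p-probability H = pH∈
      p-probability E = pE-probability

      anyEdge-always : ∀ n {q} → Probability q → Always (λ _ → ⊤) (anyEdge n q)
      anyEdge-always zero    q∈ = tt
      anyEdge-always (suc n) q∈ =
        q∈ , Always->>= (anyEdge n _) (anyEdge-always n q∈) (λ _ _ → tt)
           , Always->>= (anyEdge n _) (anyEdge-always n q∈) (λ _ _ → tt)

      𝔼-anyEdge : ∀ n q f → 𝔼 (anyEdge n q) f ≈ hit n q * f true + (1# - q) ^ n * f false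
      𝔼-anyEdge zero    q f = solve 2 (λ t e → e := con 0 :* t :+ con 1 :* e) refl (f true) (f false)
      𝔼-anyEdge (suc n) q f = begin-equality
        q * 𝔼 (anyEdge n q >>= λ b → return true) f + r * 𝔼 (anyEdge n q >>= λ b → return b) f
          ≈⟨ +-cong (*-congˡ (trans (𝔼->>= (anyEdge n q) (λ _ → return true) f) (𝔼-const (anyEdge n q) (f true))))
                    (*-congˡ (trans (𝔼->>= (anyEdge n q) return f) (𝔼-anyEdge n q f))) ⟩
        q * f true + r * (hit n q * f true + r ^ n * f false)
          ≈⟨ solve 6 (λ q r h m t e → q :* t :+ r :* (h :* t :+ m :* e) :=
                                      (q :+ r :* h) :* t :+ r :* m :* e)
               refl q r (hit n q) (r ^ n) (f true) (f false) ⟩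
        (q + r * hit n q) * f true + r * r ^ n * f false ∎
        where r = 1# - q

      -- Each advance removes one waiting agent. With the arriving agent counted, a started segment
      -- therefore has length at least one.
      localSearch-size : ∀ h e → Always (λ s → size s ℕ.≤ h ℕ.+ e) (localSearch h e)
      localSearch-size zero    zero    = ℕ.≤-refl
      localSearch-size (suc h) zero    =
        Always->>= (anyEdge (suc h) (p H)) (anyEdge-always (suc h) (p-probability H)) λ toH _ →
        Always-if toH
          (Always-map (localSearch h zero) (λ _ → ℕ.m≤n⇒m≤1+n) (localSearch-size h zero))
          ℕ.≤-refl
      localSearch-size zero    (suc e) =
        Always->>= (anyEdge (suc e) (p E)) (anyEdge-always (suc e) (p-probability E)) λ toE _ →
        Always-if toE
          (Always-map (localSearch zero e) (λ _ → ℕ.m≤n⇒m≤1+n) (localSearch-size zero e))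
          ℕ.≤-refl
      localSearch-size (suc h) (suc e) =
        Always->>= (anyEdge (suc h) (p H)) (anyEdge-always (suc h) (p-probability H)) λ toH _ →
        Always->>= (anyEdge (suc e) (p E)) (anyEdge-always (suc e) (p-probability E)) λ toE _ →
        Always-if toH
          (Always-map (localSearch h (suc e)) (λ _ → ℕ.m≤n⇒m≤1+n) (localSearch-size h (suc e)))
          (Always-if toE
            (Always-map (localSearch (suc h) e)
              (λ _ s≤ → ℕ.≤-trans s≤ (ℕ.+-monoʳ-≤ (suc h) (ℕ.n≤1+n e)))
              (localSearch-size (suc h) e))
            ℕ.≤-refl)

      join-size : ∀ T s → size (join T s) ≡ suc (size s)
      join-size H (h , e) = ≡.refl
      join-size E (h , e) = ℕ.+-suc h e

      arrivalOf-size : ∀ T s → Always (λ s′ → size s′ ℕ.≤ suc (size s)) (arrivalOf T s)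
      arrivalOf-size T s@(h , e) =
        Always->>= (anyEdge d (p T)) (anyEdge-always d (p-probability T)) λ fromBridge _ →
        Always-if fromBridge
          (Always-map (localSearch h e) (λ _ → ℕ.m≤n⇒m≤1+n) (localSearch-size h e))
          (ℕ.≤-reflexive (join-size T s))

      step-size : ∀ s → Always (λ s′ → size s′ ℕ.≤ suc (size s)) (step s)
      -- `step s` reduces to one `flip` with bias `qH` between the two kinds of arrival.
      step-size s = qH-probability , arrivalOf-size H s , arrivalOf-size E s

      -- Only the bridge edges decide whether a segment starts: any outcome of the local search
      -- counts as matched, and joining the market does not. The value is hence the same in every
      -- state.
      𝔼-arrivalOf-matched : ∀ T s → 𝔼 (arrivalOf T s) (matched s) ≈ hit d (p T)
      𝔼-arrivalOf-matched T s@(h , e) = begin-equality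
        𝔼 (arrivalOf T s) (matched s)
          ≈⟨ 𝔼->>= (anyEdge d (p T)) k (matched s) ⟩
        𝔼 (anyEdge d (p T)) (λ b → 𝔼 (k b) (matched s))
          ≈⟨ 𝔼-anyEdge d (p T) (λ b → 𝔼 (k b) (matched s)) ⟩
        hit d (p T) * 𝔼 (localSearch h e) (matched s) + (1# - p T) ^ d * matched s (join T s)
          ≈⟨ +-cong
               (*-congˡ (trans
                 (𝔼-cong (localSearch h e) (localSearch-size h e) (λ s′ → matched-smaller s s′))
                 (𝔼-const (localSearch h e) 1#)))
               (*-congˡ (matched-larger s (join T s) (join-size T s))) ⟩
        hit d (p T) * 1# + (1# - p T) ^ d * 0#
          ≈⟨ +-cong (*-identityʳ (hit d (p T))) (zeroʳ ((1# - p T) ^ d)) ⟩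
        hit d (p T) + 0#
          ≈⟨ +-identityʳ (hit d (p T)) ⟩
        hit d (p T) ∎
        where
        k : Bool → Random State
        k b = if b then localSearch h e else return (join T s)

      𝔼-step-matched : ∀ s → 𝔼 (step s) (matched s) ≈ matchProbability pH
      𝔼-step-matched s = +-cong (*-congˡ (𝔼-arrivalOf-matched H s))
                                (*-congˡ (𝔼-arrivalOf-matched E s))

      isMeanSegmentLength : 1 ℕ.≤ d → ∀ {π} → IsStationary step π →
                            IsMeanSegmentLength step π (1# / matchProbability pH)
      isMeanSegmentLength 1≤d {π} stationary =
        1# , matchProbability pH
        , HasExpectation-segmentLength
        , HasExpectation-const {matched} (<⇒≤ 0<b) 𝔼-step-matched
        , pos⇒≉0 0<b , refl
        where
        open Stationary step π stationary step-size
        0<b = 0<matchProbability 1≤d pH∈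

proposition2 : ExcludedMiddle 0ℓ →
    (R : RealField) →
    let open RealField R
        open Analysis R
    in
    (λH λE pE : ℝ) → 0# < λH → 0# < λE → 0# < pE → pE ≤ 1# →
    (d : ℕ) → 1 ℕ.≤ d →
    let chain = ChainMatch.step R λH λE pE d in
    (π : ℝ → State → ℝ) →
    (∀ pH → 0# < pH → pH < 1# → IsStationary (chain pH) (π pH)) →
    Σ[ meanL ∈ (ℝ → ℝ) ]
      (∀ pH → 0# < pH → pH < 1# →
        IsMeanSegmentLength (chain pH) (π pH) (meanL pH)) ×
      Limit0⁺ meanL
        ((λH + λE * (1# - pE) ^ d) / (λE * (1# - (1# - pE) ^ d)) + 1#)
proposition2 _ R λH λE pE 0<λH 0<λE 0<pE pE≤1 d 1≤d π stationary =
    (λ pH → 1# / matchProbability pH)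
  , (λ pH 0<pH pH<1 →
      isMeanSegmentLength pH (<⇒≤ 0<pH , <⇒≤ pH<1) 1≤d (stationary pH 0<pH pH<1))
  , Limit0⁺-matchProbability⁻¹ 1≤d
  where
  open RealField R
  open NonStrictToStrict _≈_ _≤_ using (<⇒≤)
  open ChainAnalysis R
  open Chain λH λE pE 0<λH 0<λE 0<pE pE≤1 d
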